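{- The languages $\mathcal{L}(\circ)$ and $\mathcal{L}(\Box)$ are equally expressive on the class of reflexive models ($\mathcal{T}$-models), i.e. $\mathcal{L}(\circ)\equiv\mathcal{L}(\Box)$ on that class.
   Context: Let $\mathbf{P}$ be a set of propositional variables. The language $\mathcal{L}(\circ)$ is given by $\phi::=p\mid\neg\phi\mid(\phi\land\phi)\mid\circ\phi$ and the language $\mathcal{L}(\Box)$ by $\phi::=p\mid\neg\phi\mid(\phi\land\phi)\mid\Box\phi$, with $p\in\mathbf{P}$. A model is $\mathcal{M}=\langle S,R,V\rangle$ with $S$ a nonempty set, $R\subseteq S\times S$, and $V:\mathbf{P}\to\mathcal{P}(S)$. Satisfaction at a pointed model $(\mathcal{M},s)$, $s\in S$: $\mathcal{M},s\vDash p$ iff $s\in V(p)$; Booleans as usual; $\mathcal{M},s\vDash\Box\phi$ iff $\mathcal{M},t\vDash\phi$ for all $t$ with $sRt$; $\mathcal{M},s\vDash\circ\phi$ iff ($\mathcal{M},s\vDash\phi$ implies that $\mathcal{M},t\vDash\phi$ for all $t$ with $sRt$). A model is reflexive if $sRs$ for all $s\in S$. For languages $\mathcal{L}_1,\mathcal{L}_2$ interpreted on the same class $M$ of models: $\mathcal{L}_1\preceq\mathcal{L}_2$ means that for every $\phi\in\mathcal{L}_1$ there is $\psi\in\mathcal{L}_2$ such that $\mathcal{M},s\vDash\phi$ iff $\mathcal{M},s\vDash\psi$ for all pointed models $(\mathcal{M},s)$ with $\mathcal{M}\in M$. $\mathcal{L}_1$ and $\mathcal{L}_2$ are equally expressive,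 written $\mathcal{L}_1\equiv\mathcal{L}_2$, if $\mathcal{L}_1\preceq\mathcal{L}_2$ and $\mathcal{L}_2\preceq\mathcal{L}_1$. -}

module Defs where

open import Data.Product using (_×_; ∃-syntax)
open import Function.Bundles using (_⇔_)
open import Level using (Level; _⊔_; suc)
open import Relation.Binary.Core using (Rel)
open import Relation.Binary.Definitions using (Reflexive)
open import Relation.Nullary.Negation using (¬_)
open import Relation.Unary using (Pred; _∈_)

infix 4 _,_⊨∘_ _,_⊨□_

data Form∘ {p : Level} (P : Set p) : Set p where
  var  : P → Form∘ P
  ¬′_  : Form∘ P → Form∘ P
  _∧′_ : Form∘ P → Form∘ P → Form∘ P
  ∘′_  : Form∘ P → Form∘ P

data Form□ {p : Level} (P : Set p) : Set p where
  var  : P → Form□ P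
  ¬′_  : Form□ P → Form□ P
  _∧′_ : Form□ P → Form□ P → Form□ P
  □′_  : Form□ P → Form□ P

record Model {p : Level} (P : Set p) (ℓ : Level) : Set (p ⊔ suc ℓ) where
  field
    S        : Set ℓ
    nonempty : S
    R        : Rel S ℓ
    V        : P → Pred S ℓ

open Model

_,_⊨∘_ : {p ℓ : Level} {P : Set p} (M : Model P ℓ) → S M → Form∘ P → Set ℓ
M , s ⊨∘ var q    = s ∈ V M q
M , s ⊨∘ (¬′ φ)   = ¬ (M , s ⊨∘ φ)
M , s ⊨∘ (φ ∧′ ψ) = (M , s ⊨∘ φ) × (M , s ⊨∘ ψ)
M , s ⊨∘ (∘′ φ)   = M , s ⊨∘ φ → ∀ t → R M s t → M , t ⊨∘ φ

_,_⊨□_ : {p ℓ : Level} {P : Set p} (M : Model P ℓ) → S M → Form□ P → Set ℓ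
M , s ⊨□ var q    = s ∈ V M q
M , s ⊨□ (¬′ φ)   = ¬ (M , s ⊨□ φ)
M , s ⊨□ (φ ∧′ ψ) = (M , s ⊨□ φ) × (M , s ⊨□ ψ)
M , s ⊨□ (□′ φ)   = ∀ t → R M s t → M , t ⊨□ φ

record Language {p : Level} (P : Set p) (ℓ : Level) : Set (suc (p ⊔ ℓ)) where
  field
    Form : Set p
    Sat  : (M : Model P ℓ) → S M → Form → Set ℓ

open Language

L∘ : {p : Level} (P : Set p) (ℓ : Level) → Language P ℓ
L∘ P ℓ = record { Form = Form∘ P ; Sat = _,_⊨∘_ }

L□ : {p : Level} (P : Set p) (ℓ : Level) → Language P ℓ
L□ P ℓ = record { Form = Form□ P ; Sat = _,_⊨□_ }

ReflexiveModel : {p ℓ : Level} {P : Set p} → Pred (Model P ℓ) ℓ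
ReflexiveModel M = Reflexive (R M)

AtMostAsExpressiveOn : {p ℓ c : Level} {P : Set p} → Pred (Model P ℓ) c →
                       Language P ℓ → Language P ℓ → Set (p ⊔ suc ℓ ⊔ c)
AtMostAsExpressiveOn C L₁ L₂ =
  (φ : Form L₁) → ∃[ ψ ] (∀ M → M ∈ C → (s : S M) → Sat L₁ M s φ ⇔ Sat L₂ M s ψ)

EquallyExpressiveOn : {p ℓ c : Level} {P : Set p} → Pred (Model P ℓ) c →
                      Language P ℓ → Language P ℓ → Set (p ⊔ suc ℓ ⊔ c)
EquallyExpressiveOn C L₁ L₂ =
  AtMostAsExpressiveOn C L₁ L₂ × AtMostAsExpressiveOn C L₂ L₁

{-# OPTIONS --safe #-}
-- ∘φ unfolds to φ → □φ, so ∘ is definable from □ on every model. Conversely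
-- φ ∧ ∘φ says that φ holds at s and at all successors of s, which is □φ as
-- soon as s is its own successor.
module Submission where

open import Defs
open import Axiom.ExcludedMiddle using (ExcludedMiddle)
open import Data.Product using (_,_)
open import Data.Product.Function.NonDependent.Propositional using (_×-⇔_)
open import Function.Bundles using (_⇔_; mk⇔; Equivalence)
open import Function.Construct.Identity using (⇔-id)
open import Function.Related.TypeIsomorphisms using (¬-cong-⇔)
open import Level using (Level)
open import Relation.Nullary.Decidable using (decidable-stable)

open Equivalence using (to; from)
open Model using (S)

private variable
  p ℓ : Level
  P : Set p

-- Translate by recursion on formulas and prove equivalence by induction; only the modal clauses
-- carry content. With implication spelled by negation and conjunction, ∘φ becomes ¬(φ ∧ ¬□φ), while
-- □φ becomes φ ∧ ∘φ.

∘⇒□ : Form∘ P → Form□ P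
∘⇒□ (var q)  = var q
∘⇒□ (¬′ φ)   = ¬′ ∘⇒□ φ
∘⇒□ (φ ∧′ ψ) = ∘⇒□ φ ∧′ ∘⇒□ ψ
∘⇒□ (∘′ φ)   = ¬′ (∘⇒□ φ ∧′ (¬′ (□′ ∘⇒□ φ)))

□⇒∘ : Form□ P → Form∘ P
□⇒∘ (var q)  = var q
□⇒∘ (¬′ φ)   = ¬′ □⇒∘ φ
□⇒∘ (φ ∧′ ψ) = □⇒∘ φ ∧′ □⇒∘ ψ
□⇒∘ (□′ φ)   = □⇒∘ φ ∧′ (∘′ □⇒∘ φ)

∘⇒□-correct : ExcludedMiddle ℓ → (φ : Form∘ P) (M : Model P ℓ) (s : S M) →
              M , s ⊨∘ φ ⇔ M , s ⊨□ ∘⇒□ φ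
∘⇒□-correct em (var q)  M s = ⇔-id _
∘⇒□-correct em (¬′ φ)   M s = ¬-cong-⇔ (∘⇒□-correct em φ M s)
∘⇒□-correct em (φ ∧′ ψ) M s = ∘⇒□-correct em φ M s ×-⇔ ∘⇒□-correct em ψ M s
∘⇒□-correct em (∘′ φ)   M s = mk⇔
  (λ f (h , ¬□) → ¬□ λ t r → to (ih t) (f (from (ih s) h) t r))
  -- Given φ at `s`, the negated conjunction yields only ¬¬□φ; excluded middle removes the double
  -- negation.
  (λ ¬h h t r → from (ih t) (decidable-stable em (λ ¬□ → ¬h (to (ih s) h , ¬□)) t r))
  where ih = ∘⇒□-correct em φ M

□⇒∘-correct : (φ : Form□ P) (M : Model P ℓ) → ReflexiveModel M → (s : S M) →
              M , s ⊨□ φ ⇔ M , s ⊨∘ □⇒∘ φ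
□⇒∘-correct (var q)  M rfl s = ⇔-id _
□⇒∘-correct (¬′ φ)   M rfl s = ¬-cong-⇔ (□⇒∘-correct φ M rfl s)
□⇒∘-correct (φ ∧′ ψ) M rfl s = □⇒∘-correct φ M rfl s ×-⇔ □⇒∘-correct ψ M rfl s
□⇒∘-correct (□′ φ)   M rfl s = mk⇔
  -- Reflexivity makes `s` one of its own successors, so □φ gives φ at `s` itself.
  (λ f → to (ih s) (f s rfl) , λ _ t r → to (ih t) (f t r))
  -- The conjunct φ discharges the antecedent in ∘φ.
  (λ (h , f) t r → from (ih t) (f h t r))
  where ih = □⇒∘-correct φ M rfl

proposition8 : {p ℓ : Level} → ExcludedMiddle ℓ → (P : Set p) →
    EquallyExpressiveOn ReflexiveModel (L∘ P ℓ) (L□ P ℓ)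
proposition8 em P =
  (λ φ → ∘⇒□ φ , λ M _ → ∘⇒□-correct em φ M) ,
  (λ φ → □⇒∘ φ , λ M rfl → □⇒∘-correct φ M rfl)
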